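{- There exists a constant $c_1 > 0$ such that, for all positive integers $n$, there exist integers $1 \leq a_1 < \ldots < a_k \leq n$ (for some $k$) such that there are at least $c_1 n^2$ distinct integers of the form $\sum_{i=u}^{v} a_i$ with $1 \leq u \leq v \leq k$. -}

module Defs where

open import Data.Nat using (ℕ; _≤_; _<_)
open import Data.List using (List; []; _∷_; _++_)
open import Data.Nat.ListAction using (sum)
open import Data.List.Relation.Unary.All using (All)
open import Data.List.Relation.Unary.Linked using (Linked)
open import Data.Product using (∃; ∃-syntax; _×_)
open import Relation.Binary.PropositionalEquality using (_≡_)

StrictlyIncreasingIn : ℕ → List ℕ → Set
StrictlyIncreasingIn n as = Linked _<_ as × All (λ a → 1 ≤ a × a ≤ n) as

IsBlockSum : List ℕ → ℕ → Set
IsBlockSum as s = ∃[ xs ] ∃[ y ] ∃[ ys ] ∃[ zs ]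
  (as ≡ xs ++ (y ∷ ys) ++ zs × s ≡ sum (y ∷ ys))

{-# OPTIONS --safe #-}

-- With prefix sums S(i), the block sums are the differences S(v) − S(u).  Take
--   S(i) = q i + i² + ⌊t (i ∸ N) / q⌋,   q = K N,
-- whose increments are strictly increasing (the floor lowers a second difference by at most 1,
-- while i² contributes 2) and O(N), and consider only u < N and v = N + K j with j < N.
-- The slope t / q is not fixed but averaged over all t < q N.
--
-- Consider coincidences S(v) − S(u) = S(v′) − S(u′) with j − j′ = δ > 0, the indices j, j′, u
-- being given.  For each u′ the equation prescribes the difference of the two floors; as it equals
-- t K δ / q up to an error below 1, at most 3 N / δ values of t are possible.  As t / q ≤ N,
-- that difference lies between 0 and N K δ, while consecutive S(u′) are at least q = K N
-- apart, so at most 2 δ values of u′ occur at all.  Hence there are at most 6 N pairs (u′, t): the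
-- factors δ cancel, and no logarithm is lost.  Summing over j, j′, u gives at most 6 N⁴
-- coincidences for the K N² values of t together, so for K = 12 some t has at most N² / 2
-- coincidences among its N² differences.
module Submission where

open import Defs
import Data.Nat

-- Finite sums, averaging and counting.

module FiniteSums where

  open import Data.Nat
  open import Data.Nat.Properties
  open import Data.Nat.Tactic.RingSolver using (solve-∀)
  open import Data.Product using (∃-syntax; _×_; _,_)
  open import Data.Sum using (_⊎_; inj₁; inj₂)
  open import Relation.Nullary using (Dec; yes; no; contradiction)
  open import Relation.Unary using (Pred; Decidable)
  open import Relation.Binary.PropositionalEquality

  ∑ : ℕ → (ℕ → ℕ) → ℕ
  ∑ zero    f = 0
  ∑ (suc n) f = ∑ n f + f n

  ∑-mono : ∀ n {f g} → (∀ i → i < n → f i ≤ g i) → ∑ n f ≤ ∑ n g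
  ∑-mono zero    f≤g = z≤n
  ∑-mono (suc n) f≤g = +-mono-≤ (∑-mono n (λ i i<n → f≤g i (m<n⇒m<1+n i<n))) (f≤g n ≤-refl)

  ∑-bounded : ∀ n {f c} → (∀ i → i < n → f i ≤ c) → ∑ n f ≤ n * c
  ∑-bounded zero            f≤c = z≤n
  ∑-bounded (suc n) {f} {c} f≤c = begin
    ∑ n f + f n ≤⟨ +-mono-≤ (∑-bounded n (λ i i<n → f≤c i (m<n⇒m<1+n i<n))) (f≤c n ≤-refl) ⟩
    n * c + c   ≡⟨ +-comm (n * c) c ⟩
    c + n * c   ∎
    where open ≤-Reasoning

  ∑-0 : ∀ n → ∑ n (λ _ → 0) ≡ 0
  ∑-0 zero    = refl
  ∑-0 (suc n) = trans (+-identityʳ _) (∑-0 n)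

  ∑-+ : ∀ n f g → ∑ n (λ i → f i + g i) ≡ ∑ n f + ∑ n g
  ∑-+ zero    f g = refl
  ∑-+ (suc n) f g = trans (cong (_+ (f n + g n)) (∑-+ n f g))
                          (interchange (∑ n f) (∑ n g) (f n) (g n))
    where
    interchange : ∀ a b c d → (a + b) + (c + d) ≡ (a + c) + (b + d)
    interchange = solve-∀

  ∑-*ʳ : ∀ n f c → ∑ n f * c ≡ ∑ n (λ i → f i * c)
  ∑-*ʳ zero    f c = refl
  ∑-*ʳ (suc n) f c = trans (*-distribʳ-+ c (∑ n f) (f n)) (cong (_+ f n * c) (∑-*ʳ n f c))

  ∑-swap : ∀ m n (f : ℕ → ℕ → ℕ) → ∑ m (λ i → ∑ n (f i)) ≡ ∑ n (λ j → ∑ m (λ i → f i j))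
  ∑-swap zero    n f = sym (∑-0 n)
  ∑-swap (suc m) n f = trans (cong (_+ ∑ n (f m)) (∑-swap m n f))
                             (sym (∑-+ n (λ j → ∑ m (λ i → f i j)) (f m)))

  -- Interchanging the sums makes the outer one innermost; in this way the sum over the slopes is
  -- moved past the other indices.
  ∑∑-bounded : ∀ m n {f : ℕ → ℕ → ℕ} {c} → (∀ j → j < n → ∑ m (λ i → f i j) ≤ c) →
    ∑ m (λ i → ∑ n (f i)) ≤ n * c
  ∑∑-bounded m n {f} bound = ≤-trans (≤-reflexive (∑-swap m n f)) (∑-bounded n bound)

  ∑-term : ∀ {n i} f → i < n → f i ≤ ∑ n f
  ∑-term {suc n} {i} f i<1+n with m<1+n⇒m<n∨m≡n i<1+n
  ... | inj₁ i<n  = ≤-trans (∑-term f i<n) (m≤m+n _ _)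
  ... | inj₂ refl = m≤n+m _ _

  -- If the last term exceeds `c / k`, removing it together with one `c` preserves the hypothesis
  -- for the remaining terms. The factor `k` avoids dividing `c`.
  average : ∀ n f k c → 0 < n → k * ∑ n f ≤ n * c → ∃[ i ] (i < n × k * f i ≤ c)
  average (suc n) f k c _ k∑≤ with k * f n ≤? c
  ... | yes kfn≤c = n , ≤-refl , kfn≤c
  average (suc zero) f k c _ k∑≤ | no kfn≰c =
    contradiction (≤-trans k∑≤ (≤-reflexive (+-identityʳ c))) kfn≰c
  average (suc n@(suc _)) f k c _ k∑≤ | no kfn≰c =
    let i , i<n , kfi≤c = average n f k c z<s rest in i , m<n⇒m<1+n i<n , kfi≤c
    where
    open ≤-Reasoning
    rest : k * ∑ n f ≤ n * c
    rest = +-cancelˡ-≤ c _ _ (begin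
      c + k * ∑ n f         ≤⟨ +-monoˡ-≤ _ (<⇒≤ (≰⇒> kfn≰c)) ⟩
      k * f n + k * ∑ n f   ≡⟨ +-comm (k * f n) _ ⟩
      k * ∑ n f + k * f n   ≡⟨ *-distribˡ-+ k (∑ n f) (f n) ⟨
      k * (∑ n f + f n)     ≤⟨ k∑≤ ⟩
      c + n * c             ∎)

  𝟙 : ∀ {p} {P : Set p} → Dec P → ℕ
  𝟙 (yes _) = 1
  𝟙 (no _)  = 0

  𝟙-yes : ∀ {p} {P : Set p} (P? : Dec P) → P → 1 ≤ 𝟙 P?
  𝟙-yes (yes _) _ = ≤-refl
  𝟙-yes (no ¬p) p = contradiction p ¬p

  module _ {p} {P : Pred ℕ p} (P? : Decidable P) where

    # : ℕ → ℕ
    # n = ∑ n (λ i → 𝟙 (P? i))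

    #-below-least : ∀ n → # n ≡ 0 ⊎ ∃[ i ] ∃[ s ] (i + s ≡ n × P i × # n ≤ s)
    #-below-least zero = inj₁ refl
    #-below-least (suc n) with P? n | #-below-least n
    ... | no _   | inj₁ #≡0 = inj₁ (trans (+-identityʳ _) #≡0)
    ... | yes pn | inj₁ #≡0 = inj₂ (n , 1 , +-comm n 1 , pn , ≤-reflexive (cong (_+ 1) #≡0))
    ... | no _   | inj₂ (i , s , i+s≡n , pi , #≤s) =
      inj₂ (i , suc s , trans (+-suc i s) (cong suc i+s≡n) , pi ,
            ≤-trans (≤-reflexive (+-identityʳ _)) (m≤n⇒m≤1+n #≤s))
    ... | yes _  | inj₂ (i , s , i+s≡n , pi , #≤s) =
      inj₂ (i , suc s , trans (+-suc i s) (cong suc i+s≡n) , pi ,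
            ≤-trans (≤-reflexive (+-comm _ 1)) (s≤s #≤s))

    -- A set has at most as many elements as the interval from its minimum `i` to its maximum
    -- `i + s`. Counting slopes or indices thus reduces to bounding the distance between two
    -- solutions.
    #-span : ∀ n → # n ≡ 0 ⊎ ∃[ i ] ∃[ s ] (i + s < n × P i × P (i + s) × # n ≤ suc s)
    #-span zero = inj₁ refl
    #-span (suc n) with P? n
    ... | no _ with #-span n
    ...   | inj₁ #≡0 = inj₁ (trans (+-identityʳ _) #≡0)
    ...   | inj₂ (i , s , i+s<n , pi , pi+s , #≤) =
      inj₂ (i , s , m<n⇒m<1+n i+s<n , pi , pi+s , ≤-trans (≤-reflexive (+-identityʳ _)) #≤)
    -- Here `n` is the maximum, so only the minimum remains to be found below it.
    #-span (suc n) | yes pn with #-below-least n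
    ...   | inj₁ #≡0 = inj₂ (n , 0 , s≤s (≤-reflexive (+-identityʳ n)) , pn ,
                             subst P (sym (+-identityʳ n)) pn , ≤-reflexive (cong (_+ 1) #≡0))
    ...   | inj₂ (i , s , refl , pi , #≤s) =
      inj₂ (i , s , ≤-refl , pi , pn , ≤-trans (≤-reflexive (+-comm _ 1)) (s≤s #≤s))

-- Distinct values from few collisions.

module GreedySelection where

  open import Data.Nat
  open import Data.Nat.Properties
  open import Data.List using ([]; _++_; length; filter; applyDownFrom)
  open import Data.List.Properties using (length-++)
  open import Data.List.Membership.DecPropositional _≟_ using (_∈?_)
  open import Data.List.Relation.Unary.All as All using (All; [])
  import Data.List.Relation.Unary.All.Properties as All
  open import Data.List.Relation.Unary.AllPairs using ([])
  open import Data.List.Relation.Unary.Unique.Propositional using (Unique)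
  import Data.List.Relation.Unary.Unique.Propositional.Properties as Unique
  open import Data.Nat.Tactic.RingSolver using (solve-∀)
  open import Data.Product using (∃-syntax; _×_; _,_)
  open import Relation.Nullary using (yes; no)
  open import Relation.Unary.Properties using (∁?)
  open import Relation.Binary.PropositionalEquality
  open FiniteSums

  length-filter-∉ : ∀ xs g n →
    n ≤ length (filter (∁? (_∈? xs)) (applyDownFrom g n)) + ∑ n (λ i → 𝟙 (g i ∈? xs))
  length-filter-∉ xs g zero = z≤n
  length-filter-∉ xs g (suc n) with g n ∈? xs
  ... | yes _ = ≤-trans (s≤s (length-filter-∉ xs g n))
                        (≤-reflexive (shift (length (filter (∁? (_∈? xs)) (applyDownFrom g n))) _))
    where
    shift : ∀ a b → suc (a + b) ≡ a + (b + 1)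
    shift = solve-∀
  ... | no _  = s≤s (≤-trans (length-filter-∉ xs g n)
    (+-monoʳ-≤ (length (filter (∁? (_∈? xs)) (applyDownFrom g n))) (m≤m+n _ _)))

  -- Only pairs of different rows are compared, each pair of rows once; equal values within a row
  -- are excluded separately by injectivity.
  collisions : (ℕ → ℕ → ℕ) → ℕ → ℕ → ℕ
  collisions F N J = ∑ J (λ j → ∑ j (λ j′ → ∑ N (λ u → ∑ N (λ u′ → 𝟙 (F j u ≟ F j′ u′)))))

  Value : (ℕ → ℕ → ℕ) → ℕ → ℕ → ℕ → Set
  Value F N J s = ∃[ j ] ∃[ u ] (j < J × u < N × s ≡ F j u)

  -- Rows are added one at a time, keeping only values not yet listed. A discarded value equals one
  -- of an earlier row, so a collision pays for it.
  distinct-values : ∀ F N J → (∀ {j u u′} → j < J → u′ < u → u < N → F j u ≢ F j u′) →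
    ∃[ S ] (Unique S × All (Value F N J) S × J * N ≤ length S + collisions F N J)
  distinct-values F N zero    inj = [] , [] , [] , z≤n
  distinct-values F N (suc J) inj
    with distinct-values F N J (λ j<J → inj (m<n⇒m<1+n j<J))
  ... | S , unique , values , large =
    new ++ S ,
    Unique.++⁺ (Unique.filter⁺ (∁? (_∈? S)) (Unique.applyDownFrom⁺₁ (F J) N (inj ≤-refl)))
      unique (λ { (∈new , ∈S) → All.lookup (All.all-filter (∁? (_∈? S)) row) ∈new ∈S }) ,
    All.++⁺ (All.filter⁺ (∁? (_∈? S)) (All.applyDownFrom⁺₁ (F J) N (λ {u} u<N → J , u , ≤-refl , u<N , refl)))
      (All.map (λ { (j , u , j<J , u<N , eq) → j , u , m<n⇒m<1+n j<J , u<N , eq }) values) ,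
    (begin
      N + J * N
        ≤⟨ +-mono-≤ (length-filter-∉ S (F J) N) large ⟩
      (length new + ∑ N (λ u → 𝟙 (F J u ∈? S))) + (length S + collisions F N J)
        ≤⟨ +-monoˡ-≤ _ (+-monoʳ-≤ (length new) repeats) ⟩
      (length new + ∑ J (λ j → ∑ N (λ u → ∑ N (λ u′ → 𝟙 (F J u ≟ F j u′))))) + (length S + collisions F N J)
        ≡⟨ rearrange (length new) _ (length S) (collisions F N J) ⟩
      (length new + length S) + collisions F N (suc J)
        ≡⟨ cong (_+ collisions F N (suc J)) (length-++ new) ⟨
      length (new ++ S) + collisions F N (suc J) ∎)
    where
    open ≤-Reasoning
    row = applyDownFrom (F J) N
    new = filter (∁? (_∈? S)) row
    rearrange : ∀ a b c d → (a + b) + (c + d) ≡ (a + c) + (d + b)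
    rearrange = solve-∀
    repeat : ∀ u → 𝟙 (F J u ∈? S) ≤ ∑ J (λ j → ∑ N (λ u′ → 𝟙 (F J u ≟ F j u′)))
    repeat u with F J u ∈? S
    ... | no _ = z≤n
    -- The recorded origin of the listed value names a pair `j`, `u′` whose indicator is one term of
    -- the double sum.
    ... | yes ∈S with All.lookup values ∈S
    ...   | j , u′ , j<J , u′<N , eq = begin
      1                                             ≤⟨ 𝟙-yes (F J u ≟ F j u′) eq ⟩
      𝟙 (F J u ≟ F j u′)                            ≤⟨ ∑-term (λ u′ → 𝟙 (F J u ≟ F j u′)) u′<N ⟩
      ∑ N (λ u′ → 𝟙 (F J u ≟ F j u′))               ≤⟨ ∑-term (λ j → ∑ N (λ u′ → 𝟙 (F J u ≟ F j u′))) j<J ⟩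
      ∑ J (λ j → ∑ N (λ u′ → 𝟙 (F J u ≟ F j u′)))   ∎
    repeats : ∑ N (λ u → 𝟙 (F J u ∈? S)) ≤ ∑ J (λ j → ∑ N (λ u → ∑ N (λ u′ → 𝟙 (F J u ≟ F j u′))))
    repeats = ≤-trans (∑-mono N (λ u _ → repeat u))
      (≤-reflexive (∑-swap N J (λ u j → ∑ N (λ u′ → 𝟙 (F J u ≟ F j u′)))))

-- Block sums as differences of prefix sums.

module PrefixSums where

  open import Data.Nat
  open import Data.Nat.Properties
  open import Data.Nat.ListAction using (sum)
  open import Data.Nat.ListAction.Properties using (sum-++)
  open import Data.Nat.Tactic.RingSolver using (solve-∀)
  open import Data.List using (_∷_; _++_; applyUpTo)
  open import Data.Product using (_,_)
  open import Function using (_∘_)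
  open import Relation.Binary.PropositionalEquality

  increment : (ℕ → ℕ) → ℕ → ℕ
  increment S i = S (suc i) ∸ S i

  applyUpTo-+ : ∀ {A : Set} (f : ℕ → A) m n → applyUpTo f (m + n) ≡ applyUpTo f m ++ applyUpTo (λ i → f (m + i)) n
  applyUpTo-+ f zero    n = refl
  applyUpTo-+ f (suc m) n = cong (f 0 ∷_) (applyUpTo-+ (f ∘ suc) m n)

  sum-increments : ∀ S → (∀ i → S i ≤ S (suc i)) → ∀ n → S 0 + sum (applyUpTo (increment S) n) ≡ S n
  sum-increments S mono zero    = +-identityʳ (S 0)
  sum-increments S mono (suc n) = begin
    S 0 + (S 1 ∸ S 0 + rest)   ≡⟨ +-assoc (S 0) _ _ ⟨
    S 0 + (S 1 ∸ S 0) + rest   ≡⟨ cong (_+ rest) (m+[n∸m]≡n (mono 0)) ⟩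
    S 1 + rest                 ≡⟨ sum-increments (S ∘ suc) (mono ∘ suc) n ⟩
    S (suc n)                  ∎
    where
    open ≡-Reasoning
    rest = sum (applyUpTo (increment (S ∘ suc)) n)

  sum-block : ∀ S → (∀ i → S i ≤ S (suc i)) → ∀ u d →
    S u + sum (applyUpTo (λ i → increment S (u + i)) d) ≡ S (u + d)
  sum-block S mono u d = begin
    S u + sum block                     ≡⟨ cong (_+ sum block) (sum-increments S mono u) ⟨
    S 0 + sum before + sum block        ≡⟨ +-assoc (S 0) _ _ ⟩
    S 0 + (sum before + sum block)      ≡⟨ cong (S 0 +_) (sum-++ before block) ⟨
    S 0 + sum (before ++ block)         ≡⟨ cong (λ xs → S 0 + sum xs) (applyUpTo-+ (increment S) u d) ⟨
    S 0 + sum (applyUpTo (increment S) (u + d)) ≡⟨ sum-increments S mono (u + d) ⟩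
    S (u + d)                           ∎
    where
    open ≡-Reasoning
    before = applyUpTo (increment S) u
    block  = applyUpTo (λ i → increment S (u + i)) d

  -- The block consists of the increments from index `u` up to `v - 1`; since `u < v`, its length
  -- has the form `suc d`, so it is nonempty as `IsBlockSum` demands.
  difference-isBlockSum : ∀ S → (∀ i → S i ≤ S (suc i)) → ∀ {u v k} → u < v → v ≤ k →
    IsBlockSum (applyUpTo (increment S) k) (S v ∸ S u)
  difference-isBlockSum S mono {u} u<v v≤k with m≤n⇒∃[o]m+o≡n u<v | m≤n⇒∃[o]m+o≡n v≤k
  ... | d , refl | e , refl =
    applyUpTo (increment S) u , _ , _ , applyUpTo (λ i → increment S (u + (suc d + i))) e ,
    trans (cong (applyUpTo (increment S)) (shift u d e))
      (trans (applyUpTo-+ (increment S) u (suc d + e))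
             (cong (applyUpTo (increment S) u ++_) (applyUpTo-+ (λ i → increment S (u + i)) (suc d) e))) ,
    trans (cong (λ v → S v ∸ S u) (sym (+-suc u d)))
      (trans (cong (_∸ S u) (sym (sum-block S mono u (suc d)))) (m+n∸m≡n (S u) _))
    where
    shift : ∀ u d e → suc u + d + e ≡ u + (suc d + e)
    shift = solve-∀

  -- Adding `S i + S (suc i)` to the two increments yields exactly the two sides of the convexity
  -- hypothesis, which is free of truncated subtraction.
  increment-mono-< : ∀ S → (∀ i → S i ≤ S (suc i)) →
    ∀ i → S (suc i) + S (suc i) < S i + S (suc (suc i)) → increment S i < increment S (suc i)
  increment-mono-< S mono i convex = +-cancelˡ-< (S i + S (suc i)) _ _ (begin-strict
    S i + S (suc i) + (S (suc i) ∸ S i)                      ≡⟨ swap (S i) (S (suc i)) _ ⟩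
    S (suc i) + (S i + (S (suc i) ∸ S i))                    ≡⟨ cong (S (suc i) +_) (m+[n∸m]≡n (mono i)) ⟩
    S (suc i) + S (suc i)                                    <⟨ convex ⟩
    S i + S (suc (suc i))                                    ≡⟨ cong (S i +_) (m+[n∸m]≡n (mono (suc i))) ⟨
    S i + (S (suc i) + (S (suc (suc i)) ∸ S (suc i)))        ≡⟨ +-assoc (S i) _ _ ⟨
    S i + S (suc i) + (S (suc (suc i)) ∸ S (suc i))          ∎)
    where
    open ≤-Reasoning
    swap : ∀ a b c → a + b + c ≡ b + (a + c)
    swap = solve-∀

-- Floors of linear functions.

module Floors where

  open import Data.Nat
  open import Data.Nat.Properties
  open import Data.Nat.DivMod
  open import Data.Nat.Tactic.RingSolver using (solve-∀)
  open import Relation.Binary.PropositionalEquality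

  -- The truncated difference is `max (i - n) 0`, a convex function of `i`.
  ∸-convex : ∀ n i → (suc i ∸ n) + (suc i ∸ n) ≤ (i ∸ n) + (suc (suc i) ∸ n)
  ∸-convex zero    i       = ≤-reflexive (sym (+-suc i (suc i)))
  ∸-convex (suc n) zero    = ≤-trans (≤-reflexive (cong₂ _+_ (0∸n≡0 n) (0∸n≡0 n))) z≤n
  ∸-convex (suc n) (suc i) = ∸-convex n i

  module _ (q : ℕ) .{{_ : NonZero q}} where

    open ≤-Reasoning

    φ : ℕ → ℕ → ℕ
    φ t y = t * y / q

    φ-lower : ∀ t y → φ t y * q ≤ t * y
    φ-lower t y = m/n*n≤m (t * y) q

    φ-upper : ∀ t y → t * y < suc (φ t y) * q
    φ-upper t y = begin-strict
      t * y                        ≡⟨ m≡m%n+[m/n]*n (t * y) q ⟩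
      t * y % q + φ t y * q        <⟨ +-monoˡ-< _ (m%n<n (t * y) q) ⟩
      q + φ t y * q                ∎

    φ-mono : ∀ t {y y′} → y ≤ y′ → φ t y ≤ φ t y′
    φ-mono t y≤y′ = /-monoˡ-≤ q (*-monoʳ-≤ t y≤y′)

    -- The slope `t / q` is at most `N`, and as `N * d` is an integer, taking floors costs nothing.
    φ-growth : ∀ {t N} → t ≤ q * N → ∀ y d → φ t (y + d) ≤ φ t y + N * d
    φ-growth {t} {N} t≤qN y d = s≤s⁻¹ (*-cancelʳ-< q _ _ (begin-strict
      φ t (y + d) * q              ≤⟨ φ-lower t (y + d) ⟩
      t * (y + d)                  ≡⟨ *-distribˡ-+ t y d ⟩
      t * y + t * d                <⟨ +-mono-<-≤ (φ-upper t y) (*-monoˡ-≤ d t≤qN) ⟩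
      suc (φ t y) * q + q * N * d  ≡⟨ eq (φ t y) q N d ⟩
      suc (φ t y + N * d) * q      ∎))
      where
      eq : ∀ a q N d → suc a * q + q * N * d ≡ suc (a + N * d) * q
      eq = solve-∀

    -- The two floors on the right lose less than 2 in total, hence at most 1 by integrality.
    φ-convex : ∀ t {y₀ y₁ y₂} → y₁ + y₁ ≤ y₀ + y₂ → φ t y₁ + φ t y₁ ≤ suc (φ t y₀ + φ t y₂)
    φ-convex t {y₀} {y₁} {y₂} 2y₁≤ = s≤s⁻¹ (*-cancelʳ-< q _ _ (begin-strict
      (φ t y₁ + φ t y₁) * q                   ≡⟨ *-distribʳ-+ q (φ t y₁) _ ⟩
      φ t y₁ * q + φ t y₁ * q                 ≤⟨ +-mono-≤ (φ-lower t y₁) (φ-lower t y₁) ⟩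
      t * y₁ + t * y₁                         ≡⟨ *-distribˡ-+ t y₁ y₁ ⟨
      t * (y₁ + y₁)                           ≤⟨ *-monoʳ-≤ t 2y₁≤ ⟩
      t * (y₀ + y₂)                           ≡⟨ *-distribˡ-+ t y₀ y₂ ⟩
      t * y₀ + t * y₂                         <⟨ +-mono-< (φ-upper t y₀) (φ-upper t y₂) ⟩
      suc (φ t y₀) * q + suc (φ t y₂) * q     ≡⟨ eq (φ t y₀) (φ t y₂) q ⟩
      suc (suc (φ t y₀ + φ t y₂)) * q         ∎))
      where
      eq : ∀ a b q → suc a * q + suc b * q ≡ suc (suc (a + b)) * q
      eq = solve-∀

    -- Both equations say that the floor difference is `b - a`. It is within 1 of `t * d / q`, which
    -- grows by `s * d / q` from the first slope to the second, so this growth is below 2.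
    φ-level-width : ∀ y d t s {a b} → φ t (y + d) + a ≡ φ t y + b →
      φ (t + s) (y + d) + a ≡ φ (t + s) y + b → s * d ≤ 2 * q
    φ-level-width y d t s {a} {b} eq₁ eq₂ = <⇒≤ (+-cancelˡ-< (t * (y + d) + (t + s) * y) _ _ (begin-strict
      t * (y + d) + (t + s) * y + s * d       ≡⟨ expand t s y d ⟩
      (t + s) * (y + d) + t * y               <⟨ +-mono-< (φ-upper (t + s) (y + d)) (φ-upper t y) ⟩
      suc B′ * q + suc A * q                  ≡⟨ collect B′ A q ⟩
      (B′ + A) * q + 2 * q                    ≡⟨ cong (λ z → z * q + 2 * q) balance ⟩
      (A′ + B) * q + 2 * q                    ≡⟨ cong (_+ 2 * q) (*-distribʳ-+ q A′ B) ⟩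
      (A′ * q + B * q) + 2 * q                ≤⟨ +-monoˡ-≤ _ (+-mono-≤ (φ-lower t (y + d)) (φ-lower (t + s) y)) ⟩
      t * (y + d) + (t + s) * y + 2 * q       ∎))
      where
      A = φ t y
      A′ = φ t (y + d)
      B = φ (t + s) y
      B′ = φ (t + s) (y + d)
      expand : ∀ t s y d → t * (y + d) + (t + s) * y + s * d ≡ (t + s) * (y + d) + t * y
      expand = solve-∀
      collect : ∀ a b q → suc a * q + suc b * q ≡ (a + b) * q + 2 * q
      collect = solve-∀
      regroup₁ : ∀ w x y z → (w + x) + (y + z) ≡ (w + z) + (x + y)
      regroup₁ = solve-∀
      regroup₂ : ∀ w x y z → (w + x) + (y + z) ≡ (y + w) + (z + x)
      regroup₂ = solve-∀
      balance : B′ + A ≡ A′ + B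
      balance = +-cancelʳ-≡ (a + b) _ _ (begin-equality
        (B′ + A) + (a + b)  ≡⟨ regroup₁ B′ a b A ⟨
        (B′ + a) + (b + A)  ≡⟨ cong₂ _+_ eq₂ (trans (+-comm b A) (sym eq₁)) ⟩
        (B + b) + (A′ + a)  ≡⟨ regroup₂ B b A′ a ⟩
        (A′ + B) + (a + b)  ∎)

-- The family of sequences and its collisions.

module Construction (K N : Data.Nat.ℕ) .{{_ : Data.Nat.NonZero K}} .{{_ : Data.Nat.NonZero N}} where

  open import Data.Nat
  open import Data.Nat.Properties
  open import Data.Nat.DivMod
  open import Data.Nat.Tactic.RingSolver using (solve-∀)
  open import Data.List using (List; applyUpTo)
  open import Data.Product using (∃-syntax; _×_; _,_)
  open import Data.Sum using (inj₁; inj₂)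
  open import Relation.Binary.PropositionalEquality
  open import Relation.Nullary using (yes; no; contradiction)
  import Data.List.Relation.Unary.All.Properties as All
  import Data.List.Relation.Unary.Linked.Properties as Linked
  open FiniteSums
  open GreedySelection
  open PrefixSums
  open Floors
  open ≤-Reasoning

  q T : ℕ
  q = K * N
  T = q * N

  instance
    q≢0 : NonZero q
    q≢0 = m*n≢0 K N

  p : ℕ → ℕ
  p i = q * i + i * i

  -- Truncation in `i ∸ N` switches the floor term off up to index `N`, so the early prefix sums do
  -- not depend on `t`.
  S : ℕ → ℕ → ℕ
  S t i = p i + φ q t (i ∸ N)

  F : ℕ → ℕ → ℕ → ℕ
  F t j u = S t (N + K * j) ∸ S t u

  p-gap : ∀ i s → p i + q * s ≤ p (i + s)
  p-gap i s = begin
    q * i + i * i + q * s                            ≤⟨ m≤m+n _ _ ⟩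
    q * i + i * i + q * s + (2 * (i * s) + s * s)    ≡⟨ eq q i s ⟩
    q * (i + s) + (i + s) * (i + s)                  ∎
    where
    eq : ∀ q i s → q * i + i * i + q * s + (2 * (i * s) + s * s) ≡ q * (i + s) + (i + s) * (i + s)
    eq = solve-∀

  S-early : ∀ t {u} → u < N → S t u ≡ p u
  S-early t {u} u<N = begin-equality
    p u + t * (u ∸ N) / q   ≡⟨ cong (λ y → p u + t * y / q) (m≤n⇒m∸n≡0 (<⇒≤ u<N)) ⟩
    p u + t * 0 / q         ≡⟨ cong (λ y → p u + y / q) (*-zeroʳ t) ⟩
    p u + 0 / q             ≡⟨ cong (p u +_) (0/n≡0 q) ⟩
    p u + 0                 ≡⟨ +-identityʳ (p u) ⟩
    p u                     ∎

  S-late : ∀ t y → S t (N + y) ≡ p (N + y) + φ q t y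
  S-late t y = cong (λ z → p (N + y) + φ q t z) (m+n∸m≡n N y)

  S-gap : ∀ t i s → S t i + q * s ≤ S t (i + s)
  S-gap t i s = begin
    p i + φ q t (i ∸ N) + q * s          ≡⟨ eq (p i) _ (q * s) ⟩
    p i + q * s + φ q t (i ∸ N)          ≤⟨ +-mono-≤ (p-gap i s) (φ-mono q t (∸-monoˡ-≤ N (m≤m+n i s))) ⟩
    p (i + s) + φ q t (i + s ∸ N)        ∎
    where
    eq : ∀ a b c → a + b + c ≡ a + c + b
    eq = solve-∀

  S-suc : ∀ t i → S t i < S t (suc i)
  S-suc t i = begin-strict
    S t i             <⟨ m<m+n (S t i) (>-nonZero⁻¹ q) ⟩
    S t i + q         ≡⟨ cong (S t i +_) (*-identityʳ q) ⟨
    S t i + q * 1     ≤⟨ S-gap t i 1 ⟩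
    S t (i + 1)       ≡⟨ cong (S t) (+-comm i 1) ⟩
    S t (suc i)       ∎

  S-mono : ∀ t {i j} → i ≤ j → S t i ≤ S t j
  S-mono t {i} i≤j with m≤n⇒∃[o]m+o≡n i≤j
  ... | s , refl = ≤-trans (m≤m+n _ _) (S-gap t i s)

  S-step : ∀ t i → S t i ≤ S t (suc i)
  S-step t i = <⇒≤ (S-suc t i)

  S-convex : ∀ t i → S t (suc i) + S t (suc i) < S t i + S t (suc (suc i))
  S-convex t i = begin-strict
    p (suc i) + φ₁ + (p (suc i) + φ₁)                 ≡⟨ regroup (p (suc i)) φ₁ _ _ ⟩
    p (suc i) + p (suc i) + (φ₁ + φ₁)                 ≤⟨ +-monoʳ-≤ _ (φ-convex q t (∸-convex N i)) ⟩
    p (suc i) + p (suc i) + suc (φ₀ + φ₂)             <⟨ n<1+n _ ⟩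
    -- The second difference of `p` is 2: one unit pays for the floors, the other makes the
    -- inequality strict.
    suc (p (suc i) + p (suc i) + suc (φ₀ + φ₂))       ≡⟨ eq q i (φ₀ + φ₂) ⟩
    p i + p (suc (suc i)) + (φ₀ + φ₂)                 ≡⟨ regroup (p i) φ₀ _ _ ⟨
    p i + φ₀ + (p (suc (suc i)) + φ₂)                 ∎
    where
    φ₀ = φ q t (i ∸ N)
    φ₁ = φ q t (suc i ∸ N)
    φ₂ = φ q t (suc (suc i) ∸ N)
    regroup : ∀ a b c d → a + b + (c + d) ≡ a + c + (b + d)
    regroup = solve-∀
    eq : ∀ q i x →
      suc ((q * suc i + suc i * suc i) + (q * suc i + suc i * suc i) + suc x) ≡
      (q * i + i * i) + (q * suc (suc i) + suc (suc i) * suc (suc i)) + x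
    eq = solve-∀

  -- The polynomial contributes `q + i + suc i` and the floor at most `N`; both `i` and `suc i` are
  -- at most `N + K * N`.
  increment-bound : ∀ {t i} → t ≤ T → i < N + K * N → increment (S t) i ≤ (3 * K + 3) * N
  increment-bound {t} {i} t≤T i<k = m≤n+o⇒m∸n≤o (S t (suc i)) (S t i) (begin
    p (suc i) + φ q t (suc i ∸ N)                  ≤⟨ +-monoʳ-≤ (p (suc i)) φ-step ⟩
    p (suc i) + (φ₀ + N * 1)                       ≡⟨ eq₁ q i φ₀ N ⟩
    p i + φ₀ + (q + N + (i + suc i))               ≤⟨ +-monoʳ-≤ (S t i) (+-monoʳ-≤ (q + N) (+-mono-≤ (<⇒≤ i<k) i<k)) ⟩
    p i + φ₀ + (q + N + ((N + q) + (N + q)))       ≡⟨ cong (S t i +_) (eq₂ K N) ⟩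
    S t i + (3 * K + 3) * N                        ∎)
    where
    φ₀ = φ q t (i ∸ N)
    φ-step : φ q t (suc i ∸ N) ≤ φ₀ + N * 1
    φ-step = begin
      φ q t (suc i ∸ N)        ≡⟨ cong (λ j → φ q t (j ∸ N)) (+-comm 1 i) ⟩
      φ q t (i + 1 ∸ N)        ≤⟨ φ-mono q t (m≤n+o⇒m∸n≤o (i + 1) N
                                     (≤-trans (+-monoˡ-≤ 1 (m≤n+m∸n i N)) (≤-reflexive (+-assoc N _ 1)))) ⟩
      φ q t (i ∸ N + 1)        ≤⟨ φ-growth q {t} {N} t≤T (i ∸ N) 1 ⟩
      φ₀ + N * 1               ∎
    eq₁ : ∀ q i a N → q * suc i + suc i * suc i + (a + N * 1) ≡ q * i + i * i + a + (q + N + (i + suc i))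
    eq₁ = solve-∀
    eq₂ : ∀ K N → K * N + N + ((N + K * N) + (N + K * N)) ≡ (3 * K + 3) * N
    eq₂ = solve-∀

  -- This length reaches every index `N + K * j` with `j < N`.
  sequence : ℕ → List ℕ
  sequence t = applyUpTo (increment (S t)) (N + K * N)

  sequence-increasing : ∀ {t} → t ≤ T → StrictlyIncreasingIn ((3 * K + 3) * N) (sequence t)
  sequence-increasing {t} t≤T =
    Linked.applyUpTo⁺₂ (increment (S t)) _ (λ i → increment-mono-< (S t) (S-step t) i (S-convex t i)) ,
    All.applyUpTo⁺₁ (increment (S t)) _ (λ {i} i<k → m<n⇒0<n∸m (S-suc t i) , increment-bound t≤T i<k)

  S-early≤late : ∀ t j {u} → u < N → S t u ≤ S t (N + K * j)
  S-early≤late t j u<N = S-mono t (≤-trans (<⇒≤ u<N) (m≤m+n N (K * j)))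

  value-isBlockSum : ∀ {t s} → Value (F t) N N s → IsBlockSum (sequence t) s
  value-isBlockSum {t} (j , u , j<N , u<N , refl) =
    difference-isBlockSum (S t) (S-step t) (≤-trans u<N (m≤m+n N (K * j)))
      (+-monoʳ-≤ N (*-monoʳ-≤ K (<⇒≤ j<N)))

  -- Subtractions are cleared and the floors isolated: the bracketed terms do not depend on `t`, so
  -- they can serve as `a` and `b` in `φ-level-width`.
  collision-equation : ∀ t {j j′ u u′} → u < N → u′ < N → F t j u ≡ F t j′ u′ →
    φ q t (K * j) + (p (N + K * j) + p u′) ≡ φ q t (K * j′) + (p (N + K * j′) + p u)
  collision-equation t {j} {j′} {u} {u′} u<N u′<N eq = begin-equality
    φ q t (K * j) + (p (N + K * j) + p u′)      ≡⟨ regroup (φ q t (K * j)) (p (N + K * j)) (p u′) ⟩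
    p (N + K * j) + φ q t (K * j) + p u′        ≡⟨ cong₂ _+_ (S-late t (K * j)) (S-early t u′<N) ⟨
    S t (N + K * j) + S t u′                    ≡⟨ cong (_+ S t u′) (m∸n+n≡m (S-early≤late t j u<N)) ⟨
    F t j u + S t u + S t u′                    ≡⟨ cong (λ z → z + S t u + S t u′) eq ⟩
    F t j′ u′ + S t u + S t u′                  ≡⟨ swap (F t j′ u′) _ _ ⟩
    F t j′ u′ + S t u′ + S t u                  ≡⟨ cong (_+ S t u) (m∸n+n≡m (S-early≤late t j′ u′<N)) ⟩
    S t (N + K * j′) + S t u                    ≡⟨ cong₂ _+_ (S-late t (K * j′)) (S-early t u<N) ⟩
    p (N + K * j′) + φ q t (K * j′) + p u       ≡⟨ regroup (φ q t (K * j′)) (p (N + K * j′)) (p u) ⟨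
    φ q t (K * j′) + (p (N + K * j′) + p u)     ∎
    where
    regroup : ∀ a b c → a + (b + c) ≡ b + a + c
    regroup = solve-∀
    swap : ∀ a b c → a + b + c ≡ a + c + b
    swap = solve-∀

  -- Within one row the terms at the late index cancel, leaving `p u′ ≡ p u`, although `p` is
  -- strictly increasing.
  F-injective : ∀ t {j u u′} → u′ < u → u < N → F t j u ≢ F t j u′
  F-injective t {j} {u} {u′} u′<u u<N eq with m≤n⇒∃[o]m+o≡n u′<u
  ... | s , refl = <-irrefl p≡p (begin-strict
    p u′                   <⟨ m<m+n (p u′) (≤-trans (>-nonZero⁻¹ q) (m≤m*n q (suc s))) ⟩
    p u′ + q * suc s       ≤⟨ p-gap u′ (suc s) ⟩
    p (u′ + suc s)         ≡⟨ cong p (+-suc u′ s) ⟩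
    p (suc u′ + s)         ∎)
    where
    p≡p : p u′ ≡ p (suc u′ + s)
    p≡p = +-cancelˡ-≡ (p (N + K * j)) _ _ (+-cancelˡ-≡ (φ q t (K * j)) _ _
            (collision-equation t u<N (<-trans u′<u u<N) eq))

  -- Collisions of two fixed rows, with `u` fixed as well.

  module _ (j′ δ : ℕ) (1≤δ : 1 ≤ δ) (δ≤N : δ ≤ N) {u : ℕ} (u<N : u < N) where

    private
      y = K * j′
      d = K * δ

    equation : ∀ t {u′} → u′ < N → F t (j′ + δ) u ≡ F t j′ u′ →
      φ q t (y + d) + (p (N + K * (j′ + δ)) + p u′) ≡ φ q t y + (p (N + y) + p u)
    equation t {u′} u′<N eq =
      subst (λ z → φ q t z + (p (N + K * (j′ + δ)) + p u′) ≡ φ q t y + (p (N + y) + p u))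
        (*-distribˡ-+ K j′ δ) (collision-equation t u<N u′<N eq)

    C : ℕ → ℕ
    C u′ = # (λ t → F t (j′ + δ) u ≟ F t j′ u′) T

    -- Two slopes solving the equation for the same `u′` differ by some `s` with
    -- `s * (K * δ) ≤ 2 * q`; since `q = K * N`, the factor `K` cancels.
    C-bound : ∀ {u′} → u′ < N → C u′ * δ ≤ 3 * N
    C-bound {u′} u′<N with #-span (λ t → F t (j′ + δ) u ≟ F t j′ u′) T
    ... | inj₁ C≡0 = ≤-trans (≤-reflexive (cong (_* δ) C≡0)) z≤n
    ... | inj₂ (t , s , _ , eq₁ , eq₂ , C≤) = begin
      C u′ * δ         ≤⟨ *-monoˡ-≤ δ C≤ ⟩
      -- The extra 1 in counting a span is absorbed by `δ ≤ N`.
      δ + s * δ        ≤⟨ +-mono-≤ δ≤N sδ≤2N ⟩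
      N + 2 * N        ∎
      where
      sδ≤2N : s * δ ≤ 2 * N
      sδ≤2N = *-cancelˡ-≤ K (begin
        K * (s * δ)    ≡⟨ swap K s δ ⟩
        s * (K * δ)    ≤⟨ φ-level-width q y d t s (equation t u′<N eq₁) (equation (t + s) u′<N eq₂) ⟩
        2 * (K * N)    ≡⟨ swap 2 K N ⟩
        K * (2 * N)    ∎)
        where
        swap : ∀ a b c → a * (b * c) ≡ b * (a * c)
        swap = solve-∀

    C-witness : ∀ {u′} → 0 < C u′ → ∃[ t ] (t < T × F t (j′ + δ) u ≡ F t j′ u′)
    C-witness {u′} 0<C with #-span (λ t → F t (j′ + δ) u ≟ F t j′ u′) T
    ... | inj₁ C≡0 = contradiction C≡0 (>⇒≢ 0<C)
    ... | inj₂ (t , s , t+s<T , eq , _) = t , ≤-<-trans (m≤m+n t s) t+s<T , eq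

    -- Subtracting the two equations, `p (u′ + s) - p u′` is the floor difference at `t₁` minus that
    -- at `t₂`. The former is at most `N * d = q * δ`, the latter is nonnegative, and the left side
    -- is at least `q * s`. The two slopes may differ.
    support-width : ∀ u′ s t₁ t₂ → u′ + s < N → t₁ < T →
      F t₁ (j′ + δ) u ≡ F t₁ j′ u′ → F t₂ (j′ + δ) u ≡ F t₂ j′ (u′ + s) → s ≤ δ
    support-width u′ s t₁ t₂ u′+s<N t₁<T eq₁ eq₂ = *-cancelˡ-≤ q (+-cancelˡ-≤ (p u′) _ _ (begin
      p u′ + q * s        ≤⟨ p-gap u′ s ⟩
      p (u′ + s)          ≤⟨ +-cancelˡ-≤ (A + B′) _ _ bound ⟩
      p u′ + N * d        ≡⟨ cong (p u′ +_) (swap N K δ) ⟩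
      p u′ + q * δ        ∎))
      where
      A = φ q t₁ y
      A′ = φ q t₁ (y + d)
      B = φ q t₂ y
      B′ = φ q t₂ (y + d)
      P = p (N + K * (j′ + δ))
      R = p (N + y) + p u
      swap : ∀ a b c → a * (b * c) ≡ b * a * c
      swap = solve-∀
      regroup₁ : ∀ A B′ x P R → A + B′ + x + (P + R) ≡ (B′ + (P + x)) + (A + R)
      regroup₁ = solve-∀
      regroup₂ : ∀ B R A′ P x → (B + R) + (A′ + (P + x)) ≡ A′ + B + x + (P + R)
      regroup₂ = solve-∀
      regroup₃ : ∀ A n B′ x → A + n + B′ + x ≡ A + B′ + (x + n)
      regroup₃ = solve-∀
      balance : A + B′ + p (u′ + s) ≡ A′ + B + p u′
      balance = +-cancelʳ-≡ (P + R) _ _ (begin-equality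
        A + B′ + p (u′ + s) + (P + R)          ≡⟨ regroup₁ A B′ (p (u′ + s)) P R ⟩
        (B′ + (P + p (u′ + s))) + (A + R)      ≡⟨ cong₂ _+_ (equation t₂ u′+s<N eq₂)
                                                     (sym (equation t₁ (≤-<-trans (m≤m+n u′ s) u′+s<N) eq₁)) ⟩
        (B + R) + (A′ + (P + p u′))            ≡⟨ regroup₂ B R A′ P (p u′) ⟩
        A′ + B + p u′ + (P + R)                ∎)
      bound : A + B′ + p (u′ + s) ≤ A + B′ + (p u′ + N * d)
      bound = begin
        A + B′ + p (u′ + s)         ≡⟨ balance ⟩
        A′ + B + p u′               ≤⟨ +-monoˡ-≤ (p u′) (+-mono-≤ (φ-growth q {t₁} {N} (<⇒≤ t₁<T) y d)
                                                                    (φ-mono q t₂ (m≤m+n y d))) ⟩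
        A + N * d + B′ + p u′       ≡⟨ regroup₃ A (N * d) B′ (p u′) ⟩
        A + B′ + (p u′ + N * d)     ∎

    support-bound : # (λ u′ → 0 <? C u′) N ≤ 2 * δ
    support-bound with #-span (λ u′ → 0 <? C u′) N
    ... | inj₁ #≡0 = ≤-trans (≤-reflexive #≡0) z≤n
    ... | inj₂ (u′ , s , u′+s<N , 0<C₁ , 0<C₂ , #≤) with C-witness 0<C₁ | C-witness 0<C₂
    ...   | t₁ , t₁<T , eq₁ | t₂ , t₂<T , eq₂ = begin
      # (λ u′ → 0 <? C u′) N   ≤⟨ #≤ ⟩
      -- Now `1 ≤ δ` absorbs the extra 1, giving a multiple of `δ`.
      1 + s                    ≤⟨ +-mono-≤ 1≤δ (support-width u′ s t₁ t₂ u′+s<N t₁<T eq₁ eq₂) ⟩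
      δ + δ                    ≡⟨ cong (δ +_) (+-identityʳ δ) ⟨
      2 * δ                    ∎

    -- At most `2 * δ` indices `u′` contribute, each at most `3 * N / δ`; multiplying through by `δ`
    -- avoids this division.
    ∑C-bound : ∑ N C ≤ 6 * N
    ∑C-bound = *-cancelʳ-≤ _ _ δ {{>-nonZero 1≤δ}} (begin
      ∑ N C * δ                                    ≡⟨ ∑-*ʳ N C δ ⟩
      ∑ N (λ u′ → C u′ * δ)                        ≤⟨ ∑-mono N (λ u′ → term u′) ⟩
      ∑ N (λ u′ → 𝟙 (0 <? C u′) * (3 * N))         ≡⟨ ∑-*ʳ N _ (3 * N) ⟨
      # (λ u′ → 0 <? C u′) N * (3 * N)             ≤⟨ *-monoˡ-≤ (3 * N) support-bound ⟩
      2 * δ * (3 * N)                              ≡⟨ eq δ N ⟩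
      6 * N * δ                                    ∎)
      where
      eq : ∀ δ N → 2 * δ * (3 * N) ≡ 6 * N * δ
      eq = solve-∀
      term : ∀ u′ → u′ < N → C u′ * δ ≤ 𝟙 (0 <? C u′) * (3 * N)
      term u′ u′<N with 0 <? C u′
      ... | yes _   = ≤-trans (C-bound u′<N) (m≤m+n _ 0)
      ... | no 0≮C = ≤-reflexive (cong (_* δ) (n≤0⇒n≡0 (≮⇒≥ 0≮C)))

  -- The sum over `t` is moved past those over `j`, `j′` and `u`, each of at most `N` terms; then
  -- `∑C-bound` applies with `δ = j - j′`.
  total-collisions : ∑ T (λ t → collisions (F t) N N) ≤ N * (N * (N * (6 * N)))
  total-collisions =
    ∑∑-bounded T N (λ j j<N → ≤-trans
      (∑∑-bounded T j (λ j′ j′<j → ∑∑-bounded T N (λ u u<N → pair j j′ u j<N j′<j u<N)))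
      (*-monoˡ-≤ _ (<⇒≤ j<N)))
    where
    pair : ∀ j j′ u → j < N → j′ < j → u < N →
      ∑ T (λ t → ∑ N (λ u′ → 𝟙 (F t j u ≟ F t j′ u′))) ≤ 6 * N
    pair j j′ u j<N j′<j u<N with m≤n⇒∃[o]m+o≡n (<⇒≤ j′<j)
    ... | δ , refl = ≤-trans (≤-reflexive (∑-swap T N (λ t u′ → 𝟙 (F t (j′ + δ) u ≟ F t j′ u′))))
      (∑C-bound j′ δ (+-cancelˡ-< j′ 0 δ (≤-<-trans (≤-reflexive (+-identityʳ j′)) j′<j))
        (≤-trans (m≤n+m δ j′) (<⇒≤ j<N)) u<N)

-- Choice of the constants.

module QuadraticallyMany where

  open import Data.Nat
  open import Data.Nat.Properties
  open import Data.Nat.DivMod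
  open import Data.Nat.Tactic.RingSolver using (solve-∀)
  open import Data.List using ([]; _∷_; length)
  open import Data.List.Relation.Unary.All as All using (All; []; _∷_)
  open import Data.List.Relation.Unary.AllPairs using ([]; _∷_)
  open import Data.List.Relation.Unary.Linked using ([-])
  open import Data.List.Relation.Unary.Unique.Propositional using (Unique)
  open import Data.Product using (∃-syntax; _×_; _,_; map₂)
  open import Relation.Binary.PropositionalEquality
  open FiniteSums
  open GreedySelection

  -- For some slope at most half of the `N * N` values are lost to collisions. The constant 39 is
  -- `3 * K + 3` at `K = 12`.
  many-block-sums : ∀ N .{{_ : NonZero N}} →
    ∃[ as ] (StrictlyIncreasingIn (39 * N) as ×
      ∃[ S ] (Unique S × All (IsBlockSum as) S × N * N ≤ 2 * length S))
  many-block-sums N =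
    let t , t<T , 2E≤N² = average T (λ t → collisions (F t) N N) 2 (N * N) 0<T few
        S , unique , values , N²≤S+E = distinct-values (F t) N N (λ {j} _ → F-injective t {j})
    in sequence t , sequence-increasing (<⇒≤ t<T) ,
       S , unique , All.map (value-isBlockSum {t}) values ,
       cancel (length S) (collisions (F t) N N) N²≤S+E 2E≤N²
    where
    open Construction 12 N
    open ≤-Reasoning
    0<T : 0 < T
    0<T = >-nonZero⁻¹ T {{m*n≢0 q N}}
    few : 2 * ∑ T (λ t → collisions (F t) N N) ≤ T * (N * N)
    few = begin
      2 * ∑ T (λ t → collisions (F t) N N)   ≤⟨ *-monoʳ-≤ 2 total-collisions ⟩
      -- The choice `K = 12` makes this an equality: `2 * 6 = 12` and `T = 12 * N * N`.
      2 * (N * (N * (N * (6 * N))))          ≡⟨ eq N ⟩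
      12 * N * N * (N * N)                   ∎
      where
      eq : ∀ N → 2 * (N * (N * (N * (6 * N)))) ≡ 12 * N * N * (N * N)
      eq = solve-∀
    cancel : ∀ s e → N * N ≤ s + e → 2 * e ≤ N * N → N * N ≤ 2 * s
    cancel s e N²≤s+e 2e≤N² = +-cancelʳ-≤ (N * N) _ _ (begin
      N * N + N * N          ≤⟨ +-mono-≤ N²≤s+e N²≤s+e ⟩
      (s + e) + (s + e)      ≡⟨ eq s e ⟩
      2 * s + 2 * e          ≤⟨ +-monoʳ-≤ (2 * s) 2e≤N² ⟩
      2 * s + N * N          ∎)
      where
      eq : ∀ s e → (s + e) + (s + e) ≡ 2 * s + 2 * e
      eq = solve-∀

  quadratically-many : ∀ n → 1 ≤ n →
    ∃[ as ] (StrictlyIncreasingIn n as ×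
      ∃[ S ] (Unique S × All (IsBlockSum as) S × n ^ 2 ≤ 12800 * length S))
  quadratically-many n 1≤n with n / 40 | m≡m%n+[m/n]*n n 40
  -- For `n < 40` a single block sum suffices, as `n ^ 2` is below 12800.
  ... | zero | n≡r =
    1 ∷ [] , ([-] , (≤-refl , 1≤n) ∷ []) ,
    1 ∷ [] , [] ∷ [] , ([] , 1 , [] , [] , refl , refl) ∷ [] ,
    (begin
      n ^ 2       ≤⟨ ^-monoˡ-≤ 2 n≤40 ⟩
      40 ^ 2      ≤⟨ m≤m+n 1600 11200 ⟩
      12800       ∎)
    where
    open ≤-Reasoning
    n≤40 : n ≤ 40
    n≤40 = begin
      n               ≡⟨ n≡r ⟩
      n % 40 + 0      ≡⟨ +-identityʳ _ ⟩
      n % 40          ≤⟨ <⇒≤ (m%n<n n 40) ⟩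
      40              ∎
  -- As `N ≥ 1`, rounding down to a multiple of 40 loses at most a factor 2, so `n ≤ 80 * N`; this
  -- yields `12800 = 2 * 80 ^ 2`.
  ... | N@(suc _) | n≡r+40N =
    let as , (linked , bounded) , S , unique , blockSums , N²≤2S = many-block-sums N
    in as , (linked , All.map (map₂ (λ a≤39N → ≤-trans a≤39N 39N≤n)) bounded) ,
       S , unique , blockSums ,
       (begin
         n ^ 2                       ≤⟨ ^-monoˡ-≤ 2 n≤80N ⟩
         (80 * N) ^ 2                ≡⟨ square N ⟩
         6400 * (N * N)              ≤⟨ *-monoʳ-≤ 6400 N²≤2S ⟩
         6400 * (2 * length S)       ≡⟨ *-assoc 6400 2 (length S) ⟨
         12800 * length S            ∎)
    where
    open ≤-Reasoning
    39N≤n : 39 * N ≤ n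
    39N≤n = begin
      39 * N              ≤⟨ *-monoˡ-≤ N (n≤1+n 39) ⟩
      40 * N              ≡⟨ *-comm 40 N ⟩
      N * 40              ≤⟨ m≤n+m _ _ ⟩
      n % 40 + N * 40     ≡⟨ n≡r+40N ⟨
      n                   ∎
    n≤80N : n ≤ 80 * N
    n≤80N = begin
      n                   ≡⟨ n≡r+40N ⟩
      n % 40 + N * 40     ≤⟨ +-monoˡ-≤ _ (<⇒≤ (m%n<n n 40)) ⟩
      40 + N * 40         ≤⟨ +-monoˡ-≤ _ (m≤n*m 40 N) ⟩
      N * 40 + N * 40     ≡⟨ *-distribˡ-+ N 40 40 ⟨
      N * 80              ≡⟨ *-comm N 80 ⟩
      80 * N              ∎
    square : ∀ N → (80 * N) ^ 2 ≡ 6400 * (N * N)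
    square N = trans (cong (80 * N *_) (*-identityʳ (80 * N))) ([m*n]*[o*p]≡[m*o]*[n*p] 80 N 80 N)

-- Passage to a rational constant.

open import Data.Nat using (ℕ; _^_)
open import Data.Integer using (+_)
open import Data.List using (length)
open import Data.List.Relation.Unary.All using (All)
open import Data.List.Relation.Unary.Unique.Propositional using (Unique)
open import Data.Product using (∃-syntax; _×_; _,_)
open import Data.Rational using (0ℚ; toℚᵘ; _<_; _≤_; _*_; _/_)
import Data.Nat.Properties as ℕ
import Data.Integer as ℤ
import Data.Integer.Properties as ℤ
import Data.Rational.Properties as ℚ
open import Data.Rational.Unnormalised as ℚᵘ using (mkℚᵘ)
import Data.Rational.Unnormalised.Properties as ℚᵘ
open import Relation.Binary.PropositionalEquality using (subst₂; sym; trans; cong)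

-- Among unnormalised rationals the inequality is one of integer cross products, untouched by
-- reduction to lowest terms. There the denominator is stored minus one, so `d` is matched as a
-- successor.
1/d*m≤n : ∀ d .{{_ : Data.Nat.NonZero d}} m n → m Data.Nat.≤ d Data.Nat.* n →
  (+ 1 / d) * (+ m / 1) ≤ + n / 1
1/d*m≤n d@(Data.Nat.suc d-1) m n m≤dn = ℚ.toℚᵘ-cancel-≤ (begin
  toℚᵘ ((+ 1 / d) * (+ m / 1))            ≃⟨ ℚ.toℚᵘ-homo-* (+ 1 / d) (+ m / 1) ⟩
  toℚᵘ (+ 1 / d) ℚᵘ.* toℚᵘ (+ m / 1)      ≃⟨ ℚᵘ.*-cong (ℚ.toℚᵘ-fromℚᵘ (mkℚᵘ (+ 1) d-1))
                                                        (ℚ.toℚᵘ-fromℚᵘ (mkℚᵘ (+ m) 0)) ⟩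
  mkℚᵘ (+ 1) d-1 ℚᵘ.* mkℚᵘ (+ m) 0        ≤⟨ ℚᵘ.*≤* (subst₂ ℤ._≤_ (sym lhs) (sym rhs) (ℤ.+≤+ m≤dn)) ⟩
  mkℚᵘ (+ n) 0                            ≃⟨ ℚ.toℚᵘ-fromℚᵘ (mkℚᵘ (+ n) 0) ⟨
  toℚᵘ (+ n / 1)                          ∎)
  where
  open ℚᵘ.≤-Reasoning
  lhs = trans (ℤ.*-identityʳ (+ 1 ℤ.* + m)) (ℤ.*-identityˡ (+ m))
  rhs = trans (sym (ℤ.pos-* n (d Data.Nat.* 1)))
              (cong +_ (trans (cong (n Data.Nat.*_) (ℕ.*-identityʳ d)) (ℕ.*-comm n d)))

theorem1p1 : ∃[ c₁ ] (0ℚ < c₁ × ((n : ℕ) → 1 Data.Nat.≤ n →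
    ∃[ as ] (StrictlyIncreasingIn n as ×
    ∃[ S ] (Unique S × All (IsBlockSum as) S × c₁ * ((+ (n ^ 2)) / 1) ≤ (+ (length S)) / 1))))
theorem1p1 = + 1 / 12800 , ℚ.positive⁻¹ (+ 1 / 12800) , λ n 1≤n →
  let as , increasing , S , unique , blockSums , large = QuadraticallyMany.quadratically-many n 1≤n
  in as , increasing , S , unique , blockSums , 1/d*m≤n 12800 (n ^ 2) (length S) large
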